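{- For every $K\ge1$ there is a constant $C$ such that the hypercube $G$ with $n=2^d$ vertices ($d\ge1$) satisfies $\widetilde{\mathsf{EC}}(G)\le C n\log^2 n$ for every choice of rotor sequence lengths with $\tilde\kappa\le K$.
   Context: The hypercube has vertex set $\{0,1\}^d$, two vertices adjacent iff they differ in exactly one bit. Logarithms are base 2. Unweighted deterministic walk: each vertex $u$ has a rotor sequence of length $\tilde d(u)$ of neighbours of $u$, each occurring exactly $\tilde d(u)/\deg(u)$ times, and an initial rotor position; $\tilde\kappa=\max_u\tilde d(u)/\deg(u)$. The walk moves from the current vertex to the vertex its rotor points at and then advances that rotor cyclically. $\widetilde{\mathsf{EC}}(G)$ is the maximum over start vertices and all rotor sequences/initial positions (lengths fixed) of the first time every edge has been traversed. (The paper states its bounds for specific graphs under the standing assumption $\tilde\kappa=O(1)$.) -}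

module Defs where

open import Data.Nat using (ℕ; zero; suc; _+_; _*_; _^_; _≤_; _<_; s≤s)
import Data.Nat as ℕ
open import Data.Bool using (Bool; not)
import Data.Bool as B
open import Data.Fin using (Fin; toℕ; fromℕ<)
import Data.Fin as F
open import Data.Vec using (Vec; updateAt; count; tabulate)
open import Data.Vec.Properties using (≡-dec)
open import Data.Product using (_×_; _,_; proj₁; proj₂; ∃-syntax)
open import Data.Sum using (_⊎_)
open import Relation.Nullary using (yes; no)
open import Relation.Binary.PropositionalEquality using (_≡_; refl)

Vertex : ℕ → Set
Vertex d = Vec Bool d

_≟V_ : ∀ {d} (u v : Vertex d) → Relation.Nullary.Dec (u ≡ v)
_≟V_ = ≡-dec B._≟_

-- The neighbour of u across direction i (flip bit i).  Every neighbour of u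
-- is  flip u i  for exactly one i, so neighbours are indexed by Fin d.
flip : ∀ {d} → Vertex d → Fin d → Vertex d
flip u i = updateAt u i not

-- Rotor sequence lengths:  d̃(u) = m u * d  where m u = d̃(u)/deg(u).
-- A rotor sequence at u lists neighbours (as directions).
RotorSeqs : (d : ℕ) → (Vertex d → ℕ) → Set
RotorSeqs d m = (u : Vertex d) → Fin (m u * d) → Fin d

Balanced : ∀ {d} (m : Vertex d → ℕ) → RotorSeqs d m → Set
Balanced {d} m ρ = (u : Vertex d) (i : Fin d) →
  count (F._≟ i) (tabulate (ρ u)) ≡ m u

csuc : ∀ {n} → Fin n → Fin n
csuc {suc n} i with suc (toℕ i) ℕ.≤? n
... | yes p = fromℕ< (s≤s p)
... | no _  = F.zero

RotorPos : (d : ℕ) → (Vertex d → ℕ) → Set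
RotorPos d m = (u : Vertex d) → Fin (m u * d)

advance : ∀ {d} (m : Vertex d → ℕ) → RotorPos d m → Vertex d → RotorPos d m
advance m pos u v with v ≟V u
... | yes refl = csuc (pos u)
... | no _     = pos v

State : (d : ℕ) → (Vertex d → ℕ) → Set
State d m = Vertex d × RotorPos d m

step : ∀ {d} (m : Vertex d → ℕ) → RotorSeqs d m → State d m → State d m
step m ρ (x , pos) = flip x (ρ x (pos x)) , advance m pos x

stateAt : ∀ {d} (m : Vertex d → ℕ) → RotorSeqs d m → State d m → ℕ → State d m
stateAt m ρ σ zero    = σ
stateAt m ρ σ (suc s) = step m ρ (stateAt m ρ σ s)

dirAt : ∀ {d} (m : Vertex d → ℕ) → RotorSeqs d m → State d m → ℕ → Fin d
dirAt m ρ σ s with stateAt m ρ σ s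
... | (x , pos) = ρ x (pos x)

Traverses : ∀ {d} (m : Vertex d → ℕ) → RotorSeqs d m → State d m → ℕ →
            Vertex d → Fin d → Set
Traverses m ρ σ s v i =
  dirAt m ρ σ s ≡ i × (proj₁ (stateAt m ρ σ s) ≡ v ⊎ proj₁ (stateAt m ρ σ s) ≡ flip v i)

-- Every edge has been traversed during the first T steps
-- (i.e. the edge cover time of this walk is ≤ T).
CoveredWithin : ∀ {d} (m : Vertex d → ℕ) → RotorSeqs d m → State d m → ℕ → Set
CoveredWithin {d} m ρ σ T =
  (v : Vertex d) (i : Fin d) → ∃[ s ] (s < T × Traverses m ρ σ s v i)

{-# OPTIONS --safe #-}
module Submission where

-- Fix the target edge {v, flip v i}.  Let h(u) be an integral function of the distance k of u to v
-- whose slopes s k = h k - h (k - 1) satisfy d + (d - k) s (k + 1) ≤ k s k ≤ 2 d + (d - k) s (k + 1)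
-- for 1 ≤ k ≤ d (an approximate hitting time of v).  The function d h(x) + Σ_u R_u(rotor of u),
-- where R_u stores how far the moves made from u deviate from the average over its neighbours,
-- decreases by at least d in every step of the walk that starts away from v.  The term R_v is
-- chosen so that this also holds at v as long as v is not left in direction i.  Hence the edge is
-- traversed before the initial potential is used up, and that potential is at most of order
-- K d Σ_u k s k.  Counting the edges between consecutive levels of the cube twice, with weight
-- k s k, bounds the last sum by 2 d (d + 1) 2^d.

open import Defs
open import Data.Nat using (ℕ; zero; suc; _+_; _*_; _^_; _∸_; _≤_; _<_; z≤n; s≤s; _/_; _%_)
import Data.Nat as ℕ
open import Data.Nat.Properties hiding (_≟_)
open import Data.Nat.DivMod using (m≡m%n+[m/n]*n; m%n<n; m/n*n≤m)
open import Data.Nat.Tactic.RingSolver using (solve-∀)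
open import Data.Bool using (Bool; true; false; not; if_then_else_; _xor_)
open import Data.Fin using (Fin; zero; suc; toℕ; _≟_)
open import Data.Fin.Properties using (toℕ-fromℕ<; toℕ<n)
open import Data.Vec using ([]; _∷_; lookup; count; tabulate)
open import Data.Vec.Properties using (lookup∘updateAt)
open import Data.Product using (_,_; _×_; proj₁; proj₂; ∃-syntax)
open import Data.Sum using (_⊎_; inj₁; inj₂)
open import Function using (_∘_)
open import Relation.Nullary using (yes; no; does; contradiction)
open import Relation.Binary.PropositionalEquality
  using (_≡_; _≢_; refl; sym; trans; cong; cong₂; subst; module ≡-Reasoning)
open import Algebra.Properties.Semiring.Sum +-*-semiring
  using (sum; sum-cong-≗; ∑-distrib-+; *-distribˡ-sum; *-distribʳ-sum)

-- Sums over the vertices of the cube.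

+-interchange : ∀ a b c d → (a + b) + (c + d) ≡ (a + c) + (b + d)
+-interchange = solve-∀

∑V : ∀ {d} → (Vertex d → ℕ) → ℕ
∑V {zero}  f = f []
∑V {suc d} f = ∑V (λ u → f (false ∷ u)) + ∑V (λ u → f (true ∷ u))

∑V-cong : ∀ {d} {f g : Vertex d → ℕ} → (∀ u → f u ≡ g u) → ∑V f ≡ ∑V g
∑V-cong {zero}  e = e []
∑V-cong {suc d} e = cong₂ _+_ (∑V-cong λ u → e (false ∷ u)) (∑V-cong λ u → e (true ∷ u))

∑V-mono : ∀ {d} {f g : Vertex d → ℕ} → (∀ u → f u ≤ g u) → ∑V f ≤ ∑V g
∑V-mono {zero}  e = e []
∑V-mono {suc d} e = +-mono-≤ (∑V-mono λ u → e (false ∷ u)) (∑V-mono λ u → e (true ∷ u))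

∑V-+ : ∀ {d} (f g : Vertex d → ℕ) → ∑V (λ u → f u + g u) ≡ ∑V f + ∑V g
∑V-+ {zero}  f g = refl
∑V-+ {suc d} f g =
  trans (cong₂ _+_ (∑V-+ (f ∘ (false ∷_)) (g ∘ (false ∷_))) (∑V-+ (f ∘ (true ∷_)) (g ∘ (true ∷_))))
        (+-interchange (∑V (f ∘ (false ∷_))) _ _ _)

∑V-*ˡ : ∀ {d} c (f : Vertex d → ℕ) → ∑V (λ u → c * f u) ≡ c * ∑V f
∑V-*ˡ {zero}  c f = refl
∑V-*ˡ {suc d} c f =
  trans (cong₂ _+_ (∑V-*ˡ c (f ∘ (false ∷_))) (∑V-*ˡ c (f ∘ (true ∷_))))
        (sym (*-distribˡ-+ c _ _))

∑V-const : ∀ d c → ∑V {d} (λ _ → c) ≡ 2 ^ d * c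
∑V-const zero    c = sym (+-identityʳ c)
∑V-const (suc d) c = trans (cong₂ _+_ (∑V-const d c) (∑V-const d c)) (double (2 ^ d) c)
  where
  double : ∀ x y → x * y + x * y ≡ 2 * x * y
  double = solve-∀

∑V-sum-comm : ∀ {d n} (F : Vertex d → Fin n → ℕ) →
  ∑V (λ u → sum (F u)) ≡ sum (λ i → ∑V (λ u → F u i))
∑V-sum-comm {zero}  F = refl
∑V-sum-comm {suc d} F =
  trans (cong₂ _+_ (∑V-sum-comm (λ u → F (false ∷ u))) (∑V-sum-comm (λ u → F (true ∷ u))))
        (sym (∑-distrib-+ (λ i → ∑V (λ u → F (false ∷ u) i)) (λ i → ∑V (λ u → F (true ∷ u) i))))

∑V-flip : ∀ {d} (f : Vertex d → ℕ) i → ∑V (λ u → f (flip u i)) ≡ ∑V f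
∑V-flip f zero    = +-comm (∑V (f ∘ (true ∷_))) _
∑V-flip f (suc i) = cong₂ _+_ (∑V-flip (f ∘ (false ∷_)) i) (∑V-flip (f ∘ (true ∷_)) i)

-- Applied to the rotor terms after and before a step, which differ only at the vertex just left.
-- Adding crosswise avoids truncated subtraction, as in many identities below.
∑V-update : ∀ {d} {f g : Vertex d → ℕ} x → (∀ u → u ≢ x → f u ≡ g u) →
  ∑V f + g x ≡ ∑V g + f x
∑V-update {zero} {f} {g} [] _ = +-comm (f []) (g [])
∑V-update {suc d} {f} {g} (false ∷ x) e = begin
  (∑V f₀ + ∑V f₁) + g₀ x  ≡⟨ swap-last (∑V f₀) _ _ ⟩
  (∑V f₀ + g₀ x) + ∑V f₁  ≡⟨ cong₂ _+_ (∑V-update x λ u u≢x → e (false ∷ u) λ { refl → u≢x refl })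
                                        (∑V-cong λ u → e (true ∷ u) λ ()) ⟩
  (∑V g₀ + f₀ x) + ∑V g₁  ≡⟨ swap-last (∑V g₀) _ _ ⟩
  (∑V g₀ + ∑V g₁) + f₀ x  ∎
  where
  open ≡-Reasoning
  f₀ f₁ g₀ g₁ : Vertex d → ℕ
  f₀ u = f (false ∷ u)
  f₁ u = f (true ∷ u)
  g₀ u = g (false ∷ u)
  g₁ u = g (true ∷ u)
  swap-last : ∀ a b c → (a + b) + c ≡ (a + c) + b
  swap-last = solve-∀
∑V-update {suc d} {f} {g} (true ∷ x) e = begin
  (∑V f₀ + ∑V f₁) + g₁ x  ≡⟨ +-assoc (∑V f₀) _ _ ⟩
  ∑V f₀ + (∑V f₁ + g₁ x)  ≡⟨ cong₂ _+_ (∑V-cong λ u → e (false ∷ u) λ ())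
                                        (∑V-update x λ u u≢x → e (true ∷ u) λ { refl → u≢x refl }) ⟩
  ∑V g₀ + (∑V g₁ + f₁ x)  ≡⟨ sym (+-assoc (∑V g₀) _ _) ⟩
  (∑V g₀ + ∑V g₁) + f₁ x  ∎
  where
  open ≡-Reasoning
  f₀ f₁ g₀ g₁ : Vertex d → ℕ
  f₀ u = f (false ∷ u)
  f₁ u = f (true ∷ u)
  g₀ u = g (false ∷ u)
  g₁ u = g (true ∷ u)

-- Hamming distance and its change under a flip.

mis : Bool → Bool → ℕ
mis a b = if a xor b then 1 else 0

mis-not : ∀ a b → mis (not a) b + mis a b ≡ 1
mis-not false false = refl
mis-not false true  = refl
mis-not true  false = refl
mis-not true  true  = refl

-- The 0/1 indicators of the directions leading from `u` towards `v` and away from it. The negation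
-- makes `agreement` the mismatch bit after the flip.
mismatch agreement : ∀ {d} → Vertex d → Vertex d → Fin d → ℕ
mismatch  u v i = mis (lookup u i) (lookup v i)
agreement u v i = mis (not (lookup u i)) (lookup v i)

dist codist : ∀ {d} → Vertex d → Vertex d → ℕ
dist   u v = sum (mismatch u v)
codist u v = sum (agreement u v)

codist+dist : ∀ {d} (u v : Vertex d) → codist u v + dist u v ≡ d
codist+dist []      []      = refl
codist+dist (a ∷ u) (b ∷ v) =
  trans (+-interchange (mis (not a) b) _ _ _) (cong₂ _+_ (mis-not a b) (codist+dist u v))

dist≤d : ∀ {d} (u v : Vertex d) → dist u v ≤ d
dist≤d u v = subst (dist u v ≤_) (codist+dist u v) (m≤n+m _ _)

dist≡0⇒≡ : ∀ {d} (u v : Vertex d) → dist u v ≡ 0 → u ≡ v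
dist≡0⇒≡ []          []          _ = refl
dist≡0⇒≡ (false ∷ u) (false ∷ v) e = cong (false ∷_) (dist≡0⇒≡ u v e)
dist≡0⇒≡ (true ∷ u)  (true ∷ v)  e = cong (true ∷_) (dist≡0⇒≡ u v e)

-- Only the summand at `i` changes, from `mismatch` to `agreement`. One equation thus covers steps
-- towards `v` and away from it.
dist-flip : ∀ {d} (u v : Vertex d) i →
  dist (flip u i) v + mismatch u v i ≡ dist u v + agreement u v i
dist-flip (a ∷ u) (b ∷ v) zero    = rotate (mis (not a) b) (dist u v) (mis a b)
  where
  rotate : ∀ x y z → (x + y) + z ≡ (z + y) + x
  rotate = solve-∀
dist-flip (a ∷ u) (b ∷ v) (suc i) =
  trans (+-assoc (mis a b) _ _)
        (trans (cong (mis a b +_) (dist-flip u v i)) (sym (+-assoc (mis a b) _ _)))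

mismatch-flip : ∀ {d} (u v : Vertex d) i → mismatch (flip u i) v i ≡ agreement u v i
mismatch-flip u v i = cong (λ a → mis a (lookup v i)) (lookup∘updateAt i u)

-- Both sides count the edges between levels k and suc k around v with weight g (suc k).
∑V-edges : ∀ {d} (v : Vertex d) (g : ℕ → ℕ) →
  ∑V (λ u → dist u v * g (dist u v)) ≡ ∑V (λ u → codist u v * g (suc (dist u v)))
∑V-edges v g = begin
  ∑V (λ u → dist u v * g (dist u v))
    ≡⟨ ∑V-cong (λ u → *-distribʳ-sum (g (dist u v)) (mismatch u v)) ⟩
  ∑V (λ u → sum (λ i → mismatch u v i * g (dist u v)))
    ≡⟨ ∑V-sum-comm (λ u i → mismatch u v i * g (dist u v)) ⟩
  sum (λ i → ∑V (λ u → mismatch u v i * g (dist u v)))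
    -- Reindexing by the flip turns an edge seen from its far end into the same edge seen from its
    -- near end.
    ≡⟨ sum-cong-≗ (λ i → trans (sym (∑V-flip (λ u → mismatch u v i * g (dist u v)) i))
                                (∑V-cong λ u → flipped u i)) ⟩
  sum (λ i → ∑V (λ u → agreement u v i * g (suc (dist u v))))
    ≡⟨ sym (∑V-sum-comm (λ u i → agreement u v i * g (suc (dist u v)))) ⟩
  ∑V (λ u → sum (λ i → agreement u v i * g (suc (dist u v))))
    ≡⟨ sym (∑V-cong (λ u → *-distribʳ-sum (g (suc (dist u v))) (agreement u v))) ⟩
  ∑V (λ u → codist u v * g (suc (dist u v))) ∎
  where
  open ≡-Reasoning
  bits : ∀ a b k l → l + mis a b ≡ k + mis (not a) b →
    mis (not a) b * g l ≡ mis (not a) b * g (suc k)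
  bits false true  k l e = refl
  bits true  false k l e = refl
  bits false false k l e =
    cong (λ x → 1 * g x) (trans (sym (+-identityʳ l)) (trans e (+-comm k 1)))
  bits true  true  k l e =
    cong (λ x → 1 * g x) (trans (sym (+-identityʳ l)) (trans e (+-comm k 1)))
  flipped : ∀ u i → mismatch (flip u i) v i * g (dist (flip u i) v)
                  ≡ agreement u v i * g (suc (dist u v))
  flipped u i = trans (cong (_* g (dist (flip u i) v)) (mismatch-flip u v i))
                      (bits (lookup u i) (lookup v i) (dist u v) _ (dist-flip u v i))

-- Functions of the distance, given by their increments.

-- For `g = slope d` this is the function `h`, normalised to be 0 at `v`.
climb : (ℕ → ℕ) → ℕ → ℕ
climb g zero    = 0
climb g (suc k) = climb g k + g (suc k)

climb-shift : ∀ g k → climb g (suc k) ≡ g 1 + climb (g ∘ suc) k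
climb-shift g zero    = sym (+-identityʳ (g 1))
climb-shift g (suc k) =
  trans (cong (_+ g (suc (suc k))) (climb-shift g k)) (+-assoc (g 1) _ _)

climb-monoʳ : ∀ g {k l} → k ≤ l → climb g k ≤ climb g l
climb-monoʳ g {l = zero}  z≤n = ≤-refl
climb-monoʳ g {zero}  {suc l} _ = z≤n
climb-monoʳ g {suc k} {suc l} (s≤s k≤l) with m≤n⇒m<n∨m≡n k≤l
... | inj₁ k<l  = ≤-trans (climb-monoʳ g k<l) (m≤m+n _ _)
... | inj₂ refl = ≤-refl

climb-monoˡ : ∀ {f g : ℕ → ℕ} → (∀ k → f (suc k) ≤ g (suc k)) → ∀ k → climb f k ≤ climb g k
climb-monoˡ e zero    = ≤-refl
climb-monoˡ e (suc k) = +-mono-≤ (climb-monoˡ e k) (e k)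

-- A move towards `v` removes the last increment, a move away adds the next one; the two indicators
-- select the case.
climb-flip : ∀ {d} (g : ℕ → ℕ) (u v : Vertex d) i →
  climb g (dist (flip u i) v) + mismatch u v i * g (dist u v)
    ≡ climb g (dist u v) + agreement u v i * g (suc (dist u v))
climb-flip g u v i = bits (lookup u i) (lookup v i) (dist u v) _ (dist-flip u v i)
  where
  down : ∀ k l → l + 1 ≡ k + 0 → climb g l + 1 * g k ≡ climb g k + 0
  down k l e with trans (+-comm 1 l) (trans e (+-identityʳ k))
  ... | refl = trans (cong (climb g l +_) (*-identityˡ _)) (sym (+-identityʳ _))
  up : ∀ k l → l + 0 ≡ k + 1 → climb g l + 0 ≡ climb g k + 1 * g (suc k)
  up k l e with trans (sym (+-identityʳ l)) (trans e (+-comm k 1))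
  ... | refl = +-assoc (climb g k) _ 0
  bits : ∀ a b k l → l + mis a b ≡ k + mis (not a) b →
    climb g l + mis a b * g k ≡ climb g k + mis (not a) b * g (suc k)
  bits false true  = down
  bits true  false = down
  bits false false = up
  bits true  true  = up

-- Every distance from 0 to `d` is attained. In the induction, the half agreeing with `b` supplies
-- only level 0; the other half, with distances shifted by one, supplies all further levels.
∑V-levels : ∀ {d} (v : Vertex d) (g : ℕ → ℕ) → g 0 + climb g d ≤ ∑V (λ u → g (dist u v))
∑V-levels [] g = ≤-reflexive (+-identityʳ (g 0))
∑V-levels {suc d} (b ∷ v) g = begin
  g 0 + climb g (suc d)                                    ≡⟨ cong (g 0 +_) (climb-shift g d) ⟩
  g 0 + (g 1 + climb (g ∘ suc) d)                          ≤⟨ +-mono-≤ (m+n≤o⇒m≤o (g 0) (∑V-levels v g)) (∑V-levels v (g ∘ suc)) ⟩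
  ∑V (λ u → g (dist u v)) + ∑V (λ u → g (suc (dist u v)))  ≡⟨ split b ⟩
  ∑V (λ u → g (dist u (b ∷ v)))                            ∎
  where
  open ≤-Reasoning
  split : ∀ b → ∑V (λ u → g (dist u v)) + ∑V (λ u → g (suc (dist u v)))
              ≡ ∑V (λ u → g (dist u (b ∷ v)))
  split false = refl
  split true  = +-comm (∑V (λ u → g (dist u v))) _

-- The approximate hitting time of `v`.

-- In the cube of dimension d = c + suc k, gap c k is the increment of h from distance k to
-- distance suc k, where a vertex has codistance c.
gap : ℕ → ℕ → ℕ
gap zero    k = 1
gap (suc c) k = suc ((suc c + suc k + suc c * gap c (suc k)) / suc k)

-- `gap` recurses on the codistance, starting at the antipode of `v`; this re-indexes it by the
-- distance. Level 0 has no edge towards `v`, hence the default 0.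
slope : ℕ → ℕ → ℕ
slope d zero    = 0
slope d (suc k) = gap (d ∸ suc k) k

slope-gap : ∀ c k → slope (c + suc k) (suc k) ≡ gap c k
slope-gap c k = cong (λ x → gap x k) (m+n∸n≡m c (suc k))

slope-gap′ : ∀ c k → slope (suc c + suc k) (suc (suc k)) ≡ gap c (suc k)
slope-gap′ c k =
  trans (cong (λ d → slope d (suc (suc k))) (sym (+-suc c (suc k)))) (slope-gap c (suc k))

x≤k*[1+x/k] : ∀ x k → x ≤ suc k * suc (x / suc k)
x≤k*[1+x/k] x k = begin
  x                                ≡⟨ m≡m%n+[m/n]*n x (suc k) ⟩
  x % suc k + x / suc k * suc k    ≤⟨ +-monoˡ-≤ _ (<⇒≤ (m%n<n x (suc k))) ⟩
  suc k + x / suc k * suc k        ≡⟨ *-comm (suc (x / suc k)) (suc k) ⟩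
  suc k * suc (x / suc k)          ∎
  where open ≤-Reasoning

k*[1+x/k]≤k+x : ∀ x k → suc k * suc (x / suc k) ≤ suc k + x
k*[1+x/k]≤k+x x k = begin
  suc k * suc (x / suc k)      ≡⟨ *-comm (suc k) (suc (x / suc k)) ⟩
  suc k + x / suc k * suc k    ≤⟨ +-monoʳ-≤ (suc k) (m/n*n≤m x (suc k)) ⟩
  suc k + x                    ∎
  where open ≤-Reasoning

-- Holds because `gap` exceeds the exact quotient. It means that `h` drops by at least 1 on average
-- over the neighbours of a vertex at distance `suc k`.
slope-lower : ∀ {d} c k → c + suc k ≡ d →
  d + c * slope d (suc (suc k)) ≤ suc k * slope d (suc k)
slope-lower zero    k refl =
  ≤-reflexive (trans (+-identityʳ _)
    (trans (sym (*-identityʳ (suc k))) (cong (suc k *_) (sym (slope-gap 0 k)))))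
slope-lower (suc c) k refl rewrite slope-gap (suc c) k | slope-gap′ c k = x≤k*[1+x/k] _ k

-- Replacing the exact quotient by one plus its floor costs at most `k ≤ d` after multiplication by
-- `k`; this is the second `d` in `2 * d`.
slope-upper : ∀ {d} c k → c + k ≡ d → k * slope d k ≤ 2 * d + c * slope d (suc k)
slope-upper c       zero    refl = z≤n
slope-upper zero    (suc k) refl rewrite slope-gap 0 k = begin
  suc k * 1            ≡⟨ *-identityʳ (suc k) ⟩
  suc k                ≤⟨ m≤m+n (suc k) _ ⟩
  2 * suc k            ≤⟨ m≤m+n _ 0 ⟩
  2 * suc k + 0        ∎
  where open ≤-Reasoning
slope-upper (suc c) (suc k) refl rewrite slope-gap (suc c) k | slope-gap′ c k = begin
  suc k * suc (x / suc k)  ≤⟨ k*[1+x/k]≤k+x x k ⟩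
  suc k + x                ≤⟨ +-monoˡ-≤ x (m≤n+m (suc k) (suc c)) ⟩
  d + x                    ≡⟨ regroup d (suc c * gap c (suc k)) ⟩
  2 * d + suc c * gap c (suc k) ∎
  where
  open ≤-Reasoning
  d = suc c + suc k
  x = d + suc c * gap c (suc k)
  regroup : ∀ x y → x + (x + y) ≡ 2 * x + y
  regroup = solve-∀

downSlopes upSlopes : ∀ {d} → Vertex d → Vertex d → ℕ
downSlopes {d} v u = dist u v * slope d (dist u v)
upSlopes   {d} v u = codist u v * slope d (suc (dist u v))

∑V-upSlopes : ∀ {d} (v : Vertex d) → ∑V (upSlopes v) ≡ ∑V (downSlopes v)
∑V-upSlopes {d} v = sym (∑V-edges v (slope d))

-- Summing (k + 1) * slope-upper over all vertices, the quadratic terms cancel by ∑V-edges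
-- for the weight k * slope d k.
∑V-downSlopes : ∀ {d} (v : Vertex d) → ∑V (downSlopes v) ≤ 2 ^ d * (suc d * (2 * d))
∑V-downSlopes {d} v = +-cancelˡ-≤ (∑V quad) _ _ (begin
  ∑V quad + ∑V (downSlopes v)               ≡⟨ sym (∑V-+ quad (downSlopes v)) ⟩
  ∑V (λ u → quad u + downSlopes v u)        ≤⟨ ∑V-mono pointwise ⟩
  ∑V (λ u → quad′ u + bound)                ≡⟨ ∑V-+ quad′ (λ _ → bound) ⟩
  ∑V quad′ + ∑V {d} (λ _ → bound)           ≡⟨ cong₂ _+_ (sym (∑V-edges v (λ k → k * slope d k))) (∑V-const d bound) ⟩
  ∑V quad + 2 ^ d * bound                   ∎)
  where
  open ≤-Reasoning
  bound = suc d * (2 * d)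
  quad quad′ : Vertex d → ℕ
  quad u  = dist u v * downSlopes v u
  quad′ u = codist u v * (suc (dist u v) * slope d (suc (dist u v)))
  regroup : ∀ k c s D → suc k * (D + c * s) ≡ c * (suc k * s) + suc k * D
  regroup = solve-∀
  pointwise : ∀ u → quad u + downSlopes v u ≤ quad′ u + bound
  pointwise u = begin
    k * (k * s) + k * s                 ≡⟨ +-comm (k * (k * s)) (k * s) ⟩
    suc k * (k * s)                     ≤⟨ *-monoʳ-≤ (suc k) (slope-upper c k (codist+dist u v)) ⟩
    suc k * (2 * d + c * s′)            ≡⟨ regroup k c s′ (2 * d) ⟩
    c * (suc k * s′) + suc k * (2 * d)  ≤⟨ +-monoʳ-≤ (c * (suc k * s′)) (*-monoˡ-≤ (2 * d) (s≤s (dist≤d u v))) ⟩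
    c * (suc k * s′) + bound            ∎
    where
    k = dist u v
    c = codist u v
    s = slope d k
    s′ = slope d (suc k)

-- Bounds the walker's share of the potential by the sum that also controls the rotors: weighting
-- increments by their level `k ≥ 1` only enlarges them, and every level contains a vertex.
climb≤∑V-downSlopes : ∀ {d} (x v : Vertex d) → climb (slope d) (dist x v) ≤ ∑V (downSlopes v)
climb≤∑V-downSlopes {d} x v = begin
  climb (slope d) (dist x v)       ≤⟨ climb-monoʳ (slope d) (dist≤d x v) ⟩
  climb (slope d) d                ≤⟨ climb-monoˡ (λ k → m≤n*m (slope d (suc k)) (suc k)) d ⟩
  climb (λ k → k * slope d k) d    ≤⟨ ∑V-levels v (λ k → k * slope d k) ⟩
  ∑V (downSlopes v)                ∎
  where open ≤-Reasoning

-- Sums along a rotor sequence.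

sum-const : ∀ n c → sum {n} (λ _ → c) ≡ n * c
sum-const zero    c = refl
sum-const (suc n) c = cong (c +_) (sum-const n c)

indicator : ∀ {n} → Fin n → Fin n → ℕ
indicator j i = if does (j ≟ i) then 1 else 0

indicator-≢ : ∀ {n} {j i : Fin n} → j ≢ i → indicator j i ≡ 0
indicator-≢ {j = j} {i} j≢i with j ≟ i
... | yes j≡i = contradiction j≡i j≢i
... | no _    = refl

sum-indicator : ∀ {n} (j : Fin n) (f : Fin n → ℕ) → sum (λ i → indicator j i * f i) ≡ f j
sum-indicator {suc n} zero f =
  trans (cong₂ _+_ (*-identityˡ (f zero)) (sym (*-distribˡ-sum 0 (f ∘ suc)))) (+-identityʳ (f zero))
sum-indicator (suc j) f = sum-indicator j (f ∘ suc)

count-∷ : ∀ {n d} (ρ : Fin (suc n) → Fin d) i →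
  count (_≟ i) (tabulate ρ) ≡ indicator (ρ zero) i + count (_≟ i) (tabulate (ρ ∘ suc))
count-∷ ρ i with ρ zero ≟ i
... | yes _ = refl
... | no _  = refl

sum-fibres : ∀ {n d} (ρ : Fin n → Fin d) (f : Fin d → ℕ) →
  sum (f ∘ ρ) ≡ sum (λ i → count (_≟ i) (tabulate ρ) * f i)
sum-fibres {zero}  ρ f = *-distribˡ-sum 0 f
sum-fibres {suc n} ρ f = begin
  f (ρ zero) + sum (f ∘ ρ ∘ suc)
    ≡⟨ cong₂ _+_ (sym (sum-indicator (ρ zero) f)) (sum-fibres (ρ ∘ suc) f) ⟩
  sum (λ i → indicator (ρ zero) i * f i) + sum (λ i → count (_≟ i) (tabulate (ρ ∘ suc)) * f i)
    ≡⟨ sym (∑-distrib-+ (λ i → indicator (ρ zero) i * f i) _) ⟩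
  sum (λ i → indicator (ρ zero) i * f i + count (_≟ i) (tabulate (ρ ∘ suc)) * f i)
    ≡⟨ sum-cong-≗ (λ i → sym (trans (cong (_* f i) (count-∷ ρ i))
                                     (*-distribʳ-+ (f i) (indicator (ρ zero) i) _))) ⟩
  sum (λ i → count (_≟ i) (tabulate ρ) * f i) ∎
  where open ≡-Reasoning

-- The potential of a single rotor.

-- sweep a b p = Σ_{q ≥ p} a q + Σ_{q < p} b q
sweep : ∀ {n} → (Fin n → ℕ) → (Fin n → ℕ) → ℕ → ℕ
sweep         a b zero    = sum a
sweep {zero}  a b (suc p) = 0
sweep {suc n} a b (suc p) = b zero + sweep (a ∘ suc) (b ∘ suc) p

sweep-suc : ∀ {n} (a b : Fin n → ℕ) q →
  sweep a b (suc (toℕ q)) + a q ≡ sweep a b (toℕ q) + b q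
sweep-suc a b zero    = rotate (b zero) (sum (a ∘ suc)) (a zero)
  where
  rotate : ∀ x y z → (x + y) + z ≡ (z + y) + x
  rotate = solve-∀
sweep-suc a b (suc q) =
  trans (+-assoc (b zero) _ _)
        (trans (cong (b zero +_) (sweep-suc (a ∘ suc) (b ∘ suc) q)) (sym (+-assoc (b zero) _ _)))

sweep-full : ∀ {n} (a b : Fin n → ℕ) → sweep a b n ≡ sum b
sweep-full {zero}  a b = refl
sweep-full {suc n} a b = cong (b zero +_) (sweep-full (a ∘ suc) (b ∘ suc))

sweep≤ : ∀ {n} (a b : Fin n → ℕ) p → sweep a b p ≤ sum a + sum b
sweep≤         a b zero    = m≤m+n _ _
sweep≤ {zero}  a b (suc p) = z≤n
sweep≤ {suc n} a b (suc p) = begin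
  b zero + sweep (a ∘ suc) (b ∘ suc) p            ≤⟨ +-monoʳ-≤ (b zero) (sweep≤ (a ∘ suc) (b ∘ suc) p) ⟩
  b zero + (sum (a ∘ suc) + sum (b ∘ suc))        ≤⟨ m≤n+m _ (a zero) ⟩
  a zero + (b zero + (sum (a ∘ suc) + sum (b ∘ suc))) ≡⟨ regroup (a zero) (b zero) _ _ ⟩
  (a zero + sum (a ∘ suc)) + (b zero + sum (b ∘ suc)) ∎
  where
  open ≤-Reasoning
  regroup : ∀ x y z w → x + (y + (z + w)) ≡ (x + z) + (y + w)
  regroup = solve-∀

-- Past the last position `sweep` reaches `sum b`, but the rotor returns to 0, where it is `sum a`;
-- equal sums make the wrap-around consistent.
sweep-csuc : ∀ {n} (a b : Fin n → ℕ) → sum a ≡ sum b → ∀ q →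
  sweep a b (toℕ (csuc q)) + a q ≡ sweep a b (toℕ q) + b q
sweep-csuc {suc n} a b a≡b q with suc (toℕ q) ℕ.≤? n
... | yes p = trans (cong (λ x → sweep a b x + a q) (toℕ-fromℕ< (s≤s p))) (sweep-suc a b q)
... | no ¬p = trans (cong (_+ a q) (trans a≡b (trans (sym (sweep-full a b)) (cong (sweep a b) last))))
                    (sweep-suc a b q)
  where
  last : suc n ≡ suc (toℕ q)
  last = ≤-antisym (≰⇒> ¬p) (toℕ<n q)

-- If p and q are the positive and negative parts of the change of a function along the d
-- directions, rot is the term R_u up to an additive constant that makes it nonnegative.
module Rotor {d M} (ρ : Fin (M * d) → Fin d)
             (balanced : ∀ i → count (_≟ i) (tabulate ρ) ≡ M) (p q : Fin d → ℕ) where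

  -- Balance enters here: in one full cycle every direction occurs `M` times.
  sum∘ρ : ∀ f → sum (f ∘ ρ) ≡ M * sum f
  sum∘ρ f = trans (sum-fibres ρ f)
    (trans (sum-cong-≗ λ i → cong (_* f i) (balanced i)) (sym (*-distribˡ-sum M f)))

  -- `after r` minus `before r` is `d` times the mean change over all directions minus `d` times the
  -- change in direction `ρ r`. Added to `d` times the actual change, it leaves `sum p` minus
  -- `sum q`, whichever direction is taken.
  before after : Fin (M * d) → ℕ
  before r = d * p (ρ r) + sum q
  after  r = sum p + d * q (ρ r)

  rot : Fin (M * d) → ℕ
  rot r = sweep before after (toℕ r)

  private
    scaled : ∀ f → sum (λ r → d * f (ρ r)) ≡ M * d * sum f
    scaled f = trans (sym (*-distribˡ-sum d (f ∘ ρ)))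
      (trans (cong (d *_) (sum∘ρ f)) (regroup d M (sum f)))
      where
      regroup : ∀ x y z → x * (y * z) ≡ y * x * z
      regroup = solve-∀

    sum-before : sum before ≡ M * d * (sum p + sum q)
    sum-before = trans (∑-distrib-+ (λ r → d * p (ρ r)) _)
      (trans (cong₂ _+_ (scaled p) (sum-const (M * d) (sum q))) (sym (*-distribˡ-+ (M * d) _ _)))

    sum-after : sum after ≡ M * d * (sum p + sum q)
    sum-after = trans (∑-distrib-+ {M * d} (λ _ → sum p) _)
      (trans (cong₂ _+_ (sum-const (M * d) (sum p)) (scaled q)) (sym (*-distribˡ-+ (M * d) _ _)))

  rot-csuc : ∀ r → rot (csuc r) + before r ≡ rot r + after r
  rot-csuc = sweep-csuc before after (trans sum-before (sym sum-after))

  rot≤ : ∀ r → rot r ≤ M * d * (sum p + sum q) + M * d * (sum p + sum q)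
  rot≤ r = ≤-trans (sweep≤ before after (toℕ r)) (≤-reflexive (cong₂ _+_ sum-before sum-after))

-- Decrease of the potential along the walk.

advance-updates : ∀ {d} (m : Vertex d → ℕ) (pos : RotorPos d m) x →
  advance m pos x x ≡ csuc (pos x)
advance-updates m pos x with x ≟V x
... | yes refl = refl
... | no x≢x   = contradiction refl x≢x

advance-minimal : ∀ {d} (m : Vertex d → ℕ) (pos : RotorPos d m) x u → u ≢ x →
  advance m pos x u ≡ pos u
advance-minimal m pos x u u≢x with u ≟V x
... | yes refl = contradiction refl u≢x
... | no _     = refl

module Potential {d} (m : Vertex d → ℕ) (ρ : RotorSeqs d m) (balanced : Balanced m ρ)
                 (v : Vertex d) (i : Fin d) where

  private
    Δ : ℕ → ℕ
    Δ = slope d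

  -- Leaving `v` raises `d * h` by `d * Δ 1`; the further `d` is the decrease demanded of every
  -- step.
  kick : ℕ
  kick = d * Δ 1 + d

  -- At v these are not the changes of climb Δ: there R_v must drop by kick, which pays for the
  -- ascent from v, whenever the rotor passes a direction other than i.
  rise : ℕ → ℕ → ℕ
  rise zero    y = 0
  rise (suc k) y = y * Δ (suc (suc k))

  fall : ℕ → ℕ → Fin d → ℕ
  fall zero    x j = indicator i j * kick
  fall (suc k) x j = x * Δ (suc k)

  totalFall : ℕ → ℕ
  totalFall zero    = kick
  totalFall (suc k) = suc k * Δ (suc k)

  sum-rise : ∀ k (y : Fin d → ℕ) → sum (λ j → rise k (y j)) ≡ rise k (sum y)
  sum-rise zero    y = sym (*-distribˡ-sum 0 y)
  sum-rise (suc k) y = sym (*-distribʳ-sum (Δ (suc (suc k))) y)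

  sum-fall : ∀ k (x : Fin d → ℕ) → sum x ≡ k → sum (λ j → fall k (x j) j) ≡ totalFall k
  sum-fall zero    x e = sum-indicator i (λ _ → kick)
  sum-fall (suc k) x e = trans (sym (*-distribʳ-sum (Δ (suc k)) x)) (cong (_* Δ (suc k)) e)

  risesAt fallsAt : Vertex d → Fin d → ℕ
  risesAt u j = rise (dist u v) (agreement u v j)
  fallsAt u j = fall (dist u v) (mismatch u v j) j

  sum-risesAt : ∀ u → sum (risesAt u) ≡ rise (dist u v) (codist u v)
  sum-risesAt u = sum-rise (dist u v) (agreement u v)

  sum-fallsAt : ∀ u → sum (fallsAt u) ≡ totalFall (dist u v)
  sum-fallsAt u = sum-fall (dist u v) (mismatch u v) refl

  module R u = Rotor {M = m u} (ρ u) (balanced u) (risesAt u) (fallsAt u)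

  Φ : State d m → ℕ
  Φ (x , pos) = d * climb Δ (dist x v) + ∑V (λ u → R.rot u (pos u))

  -- Primed values are those after the step. At `k = 0` the `kick` covers the ascent. For `k > 0`
  -- the terms depending on the direction cancel between walker and rotor, and `slope-lower`
  -- remains.
  local-decrease : ∀ c k x y l l′ r r′ j →
    c + k ≡ d → y ≤ 1 → (k ≡ 0 → j ≢ i) →
    l′ + x * Δ k ≡ l + y * Δ (suc k) →
    r′ + (d * rise k y + totalFall k) ≡ r + (rise k c + d * fall k x j) →
    (d * l′ + r′) + d ≤ d * l + r
  local-decrease c zero x y l l′ r r′ j _ y≤1 j≢i el er = begin
    (d * l′ + r′) + d               ≤⟨ +-monoˡ-≤ d (+-monoˡ-≤ r′ (*-monoʳ-≤ d l′≤)) ⟩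
    (d * (l + Δ 1) + r′) + d        ≡⟨ regroup d l (Δ 1) r′ ⟩
    d * l + (r′ + (d * 0 + kick))   ≡⟨ cong (d * l +_) er ⟩
    d * l + (r + d * (indicator i j * kick))
      -- Only direction `i` would hand back `d * kick` to the rotor at `v`.
      ≡⟨ cong (λ z → d * l + (r + d * (z * kick))) (indicator-≢ (λ i≡j → j≢i refl (sym i≡j))) ⟩
    d * l + (r + d * 0)             ≡⟨ cong (λ z → d * l + (r + z)) (*-zeroʳ d) ⟩
    d * l + (r + 0)                 ≡⟨ cong (d * l +_) (+-identityʳ r) ⟩
    d * l + r                       ∎
    where
    open ≤-Reasoning
    regroup : ∀ d l s r → (d * (l + s) + r) + d ≡ d * l + (r + (d * 0 + (d * s + d)))
    regroup = solve-∀
    l′≤ : l′ ≤ l + Δ 1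
    l′≤ = begin
      l′                ≤⟨ m≤m+n l′ (x * Δ 0) ⟩
      l′ + x * Δ 0      ≡⟨ el ⟩
      l + y * Δ 1       ≤⟨ +-monoʳ-≤ l (*-monoˡ-≤ (Δ 1) y≤1) ⟩
      l + 1 * Δ 1       ≡⟨ cong (l +_) (*-identityˡ (Δ 1)) ⟩
      l + Δ 1           ∎
  local-decrease c (suc k) x y l l′ r r′ j c+k y≤1 _ el er =
    +-cancelʳ-≤ (d * X + d * Y + K) _ _ (begin
      ((d * l′ + r′) + d) + (d * X + d * Y + K)    ≡⟨ regroup₁ d l′ r′ X Y K ⟩
      (d * (l′ + X) + (r′ + (d * Y + K))) + d      ≡⟨ cong₂ (λ z w → (d * z + w) + d) el er ⟩
      (d * (l + Y) + (r + (C + d * X))) + d        ≡⟨ regroup₂ d l r X Y C ⟩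
      (d * l + r) + (d * X + d * Y + (d + C))      ≤⟨ +-monoʳ-≤ (d * l + r) (+-monoʳ-≤ (d * X + d * Y) (slope-lower c k c+k)) ⟩
      (d * l + r) + (d * X + d * Y + K)            ∎)
    where
    open ≤-Reasoning
    X = x * Δ (suc k)
    Y = y * Δ (suc (suc k))
    K = suc k * Δ (suc k)
    C = c * Δ (suc (suc k))
    regroup₁ : ∀ d l r X Y K →
      ((d * l + r) + d) + (d * X + d * Y + K) ≡ (d * (l + X) + (r + (d * Y + K))) + d
    regroup₁ = solve-∀
    regroup₂ : ∀ d l r X Y C →
      (d * (l + Y) + (r + (C + d * X))) + d ≡ (d * l + r) + (d * X + d * Y + (d + C))
    regroup₂ = solve-∀

  move-decrease : ∀ u (p : Fin (m u * d)) → (dist u v ≡ 0 → ρ u p ≢ i) →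
    (d * climb Δ (dist (flip u (ρ u p)) v) + R.rot u (csuc p)) + d
      ≤ d * climb Δ (dist u v) + R.rot u p
  move-decrease u p far =
    local-decrease (codist u v) (dist u v) (mismatch u v j) (agreement u v j) _ _ _ _ j
      (codist+dist u v) (m+n≤o⇒m≤o _ (≤-reflexive (mis-not (lookup u j) (lookup v j)))) far
      (climb-flip Δ u v j)
      (trans (cong (λ z → R.rot u (csuc p) + (d * risesAt u j + z)) (sym (sum-fallsAt u)))
        (trans (R.rot-csuc u p) (cong (λ z → R.rot u p + (z + d * fallsAt u j)) (sum-risesAt u))))
    where
    j = ρ u p

  Φ-step : ∀ x pos → (dist x v ≡ 0 → ρ x (pos x) ≢ i) →
    Φ (step m ρ (x , pos)) + d ≤ Φ (x , pos)
  Φ-step x pos far = +-cancelʳ-≤ r _ _ (begin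
    ((L′ + A′) + d) + r    ≡⟨ regroup₁ L′ A′ d r ⟩
    (L′ + d) + (A′ + r)    ≡⟨ cong ((L′ + d) +_) updated ⟩
    (L′ + d) + (A + r′)    ≡⟨ regroup₂ L′ d A r′ ⟩
    ((L′ + r′) + d) + A    ≤⟨ +-monoˡ-≤ A (move-decrease x (pos x) far) ⟩
    (L + r) + A            ≡⟨ regroup₃ L r A ⟩
    (L + A) + r            ∎)
    where
    open ≤-Reasoning
    L  = d * climb Δ (dist x v)
    L′ = d * climb Δ (dist (flip x (ρ x (pos x))) v)
    A  = ∑V (λ u → R.rot u (pos u))
    A′ = ∑V (λ u → R.rot u (advance m pos x u))
    r  = R.rot x (pos x)
    r′ = R.rot x (csuc (pos x))
    updated : A′ + r ≡ A + r′
    updated = trans (∑V-update x λ u u≢x → cong (R.rot u) (advance-minimal m pos x u u≢x))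
                    (cong (λ z → A + R.rot x z) (advance-updates m pos x))
    regroup₁ : ∀ a b c e → ((a + b) + c) + e ≡ (a + c) + (b + e)
    regroup₁ = solve-∀
    regroup₂ : ∀ a b c e → (a + b) + (c + e) ≡ ((a + e) + b) + c
    regroup₂ = solve-∀
    regroup₃ : ∀ a b c → (a + b) + c ≡ (a + c) + b
    regroup₃ = solve-∀

  Φ-decreased : ∀ σ t → Φ (stateAt m ρ σ t) + t * d ≤ Φ σ →
    (dist (proj₁ (stateAt m ρ σ t)) v ≡ 0 → dirAt m ρ σ t ≢ i) →
    Φ (stateAt m ρ σ (suc t)) + suc t * d ≤ Φ σ
  Φ-decreased σ t dec far = begin
    Φ (stateAt m ρ σ (suc t)) + (d + t * d)  ≡⟨ sym (+-assoc (Φ (stateAt m ρ σ (suc t))) d _) ⟩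
    (Φ (stateAt m ρ σ (suc t)) + d) + t * d  ≤⟨ +-monoˡ-≤ (t * d) (Φ-step _ (proj₂ (stateAt m ρ σ t)) far) ⟩
    Φ (stateAt m ρ σ t) + t * d              ≤⟨ dec ⟩
    Φ σ                                      ∎
    where open ≤-Reasoning

  -- Only exits from `v` in direction `i` are looked for. A crossing from the other end is an
  -- ordinary step away from `v` and lowers `Φ` as well.
  traversed-or-Φ-decreased : ∀ σ t →
    (∃[ s ] (s < t × Traverses m ρ σ s v i)) ⊎ (Φ (stateAt m ρ σ t) + t * d ≤ Φ σ)
  traversed-or-Φ-decreased σ zero = inj₂ (≤-reflexive (+-identityʳ (Φ σ)))
  traversed-or-Φ-decreased σ (suc t) with traversed-or-Φ-decreased σ t
  ... | inj₁ (s , s<t , tr) = inj₁ (s , m<n⇒m<1+n s<t , tr)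
  ... | inj₂ dec with dist (proj₁ (stateAt m ρ σ t)) v ℕ.≟ 0 | dirAt m ρ σ t ≟ i
  ...   | yes at-v | yes dir = inj₁ (t , ≤-refl , dir , inj₁ (dist≡0⇒≡ _ v at-v))
  ...   | no far   | _       = inj₂ (Φ-decreased σ t dec λ e → contradiction e far)
  ...   | yes _    | no turn = inj₂ (Φ-decreased σ t dec λ _ → turn)

  -- Size of the initial potential and the cover time.

  -- The extra `d` serves the vertex `v`, where `kick` exceeds `upSlopes v v`, that is `d * Δ 1`, by
  -- `d`.
  localSlopes : Vertex d → ℕ
  localSlopes u = (upSlopes v u + downSlopes v u) + d

  sum-rises+falls≤ : ∀ u → sum (risesAt u) + sum (fallsAt u) ≤ localSlopes u
  sum-rises+falls≤ u rewrite sum-risesAt u | sum-fallsAt u =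
    bound (codist u v) (dist u v) (codist+dist u v)
    where
    open ≤-Reasoning
    bound : ∀ c k → c + k ≡ d → rise k c + totalFall k ≤ (c * Δ (suc k) + k * Δ k) + d
    bound c zero    c+0≡d = begin
      d * Δ 1 + d              ≡⟨ cong (λ z → z * Δ 1 + d) (trans (sym c+0≡d) (+-identityʳ c)) ⟩
      c * Δ 1 + d              ≡⟨ cong (_+ d) (sym (+-identityʳ (c * Δ 1))) ⟩
      (c * Δ 1 + 0) + d        ∎
    bound c (suc k) _ = m≤m+n _ d

  -- The factor 2 comes from bounding a sweep by both of its full sums. Up and down slopes have
  -- equal totals by double counting, and the summands `d` of `localSlopes` add up to `2 ^ d * d`.
  Φ≤ : ∀ K → (∀ u → m u ≤ K) → ∀ σ →
    Φ σ ≤ d * ∑V (downSlopes v) + 2 * (K * d) * ((∑V (downSlopes v) + ∑V (downSlopes v)) + 2 ^ d * d)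
  Φ≤ K m≤K (x , pos) = +-mono-≤ (*-monoʳ-≤ d (climb≤∑V-downSlopes x v)) (begin
    ∑V (λ u → R.rot u (pos u))                     ≤⟨ ∑V-mono rot≤ ⟩
    ∑V (λ u → 2 * (K * d) * localSlopes u)         ≡⟨ ∑V-*ˡ (2 * (K * d)) localSlopes ⟩
    2 * (K * d) * ∑V localSlopes                   ≡⟨ cong (2 * (K * d) *_) ∑V-localSlopes ⟩
    2 * (K * d) * ((∑V (downSlopes v) + ∑V (downSlopes v)) + 2 ^ d * d) ∎)
    where
    open ≤-Reasoning
    double : ∀ a b → a * b + a * b ≡ 2 * a * b
    double = solve-∀
    rot≤ : ∀ u → R.rot u (pos u) ≤ 2 * (K * d) * localSlopes u
    rot≤ u = begin
      R.rot u (pos u)                  ≤⟨ R.rot≤ u (pos u) ⟩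
      m u * d * s + m u * d * s        ≤⟨ +-mono-≤ each each ⟩
      K * d * localSlopes u + K * d * localSlopes u ≡⟨ double (K * d) (localSlopes u) ⟩
      2 * (K * d) * localSlopes u      ∎
      where
      s = sum (risesAt u) + sum (fallsAt u)
      each : m u * d * s ≤ K * d * localSlopes u
      each = *-mono-≤ (*-monoˡ-≤ d (m≤K u)) (sum-rises+falls≤ u)
    ∑V-localSlopes : ∑V localSlopes ≡ (∑V (downSlopes v) + ∑V (downSlopes v)) + 2 ^ d * d
    ∑V-localSlopes = trans (∑V-+ (λ u → upSlopes v u + downSlopes v u) (λ _ → d))
      (cong₂ _+_ (trans (∑V-+ (upSlopes v) (downSlopes v)) (cong (_+ ∑V (downSlopes v)) (∑V-upSlopes v)))
                 (∑V-const d d))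

theorem3p16 : (K : ℕ) → 1 ≤ K → ∃[ C ] ((d : ℕ) → 1 ≤ d →
    (m : Vertex d → ℕ) → ((u : Vertex d) → 1 ≤ m u) → ((u : Vertex d) → m u ≤ K) →
    (ρ : RotorSeqs d m) → Balanced m ρ →
    (init : RotorPos d m) → (x₀ : Vertex d) →
    CoveredWithin m ρ (x₀ , init) (C * 2 ^ d * d ^ 2))
-- With `S ≤ 4 * n * d ^ 2` the walker contributes 4 and the rotors `2 * K * (4 + 4 + 1)`, in units
-- of `n * d ^ 3`; one more unit makes the inequality strict.
theorem3p16 K _ = 5 + 18 * K , covered
  where
  covered : (d : ℕ) → 1 ≤ d →
    (m : Vertex d → ℕ) → ((u : Vertex d) → 1 ≤ m u) → ((u : Vertex d) → m u ≤ K) →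
    (ρ : RotorSeqs d m) → Balanced m ρ →
    (init : RotorPos d m) → (x₀ : Vertex d) →
    CoveredWithin m ρ (x₀ , init) ((5 + 18 * K) * 2 ^ d * d ^ 2)
  covered d@(suc _) _ m _ m≤K ρ balanced init x₀ v i
    with Potential.traversed-or-Φ-decreased m ρ balanced v i (x₀ , init) ((5 + 18 * K) * 2 ^ d * d ^ 2)
  ... | inj₁ traversed = traversed
  -- Since the final potential is nonnegative, the total decrease, `d` per step, cannot exceed the
  -- initial potential.
  ... | inj₂ Φ-dec = contradiction (≤-trans (m≤n+m _ _) (≤-trans Φ-dec Φ₀≤)) (<⇒≱ Φ₀<)
    where
    open Potential m ρ balanced v i
    open ≤-Reasoning
    n = 2 ^ d
    S = ∑V (downSlopes v)
    S≤ : S ≤ 4 * n * d ^ 2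
    S≤ = begin
      S                          ≤⟨ ∑V-downSlopes v ⟩
      n * (suc d * (2 * d))      ≤⟨ *-monoʳ-≤ n (*-monoˡ-≤ (2 * d) (+-monoˡ-≤ d {1} {d} (s≤s z≤n))) ⟩
      n * ((d + d) * (2 * d))    ≡⟨ regroup n d ⟩
      4 * n * d ^ 2              ∎
      where
      regroup : ∀ n d → n * ((d + d) * (2 * d)) ≡ 4 * n * (d * (d * 1))
      regroup = solve-∀
    n*d≤ : n * d ≤ n * d ^ 2
    n*d≤ = *-monoʳ-≤ n (m≤m*n d (d * 1))
    Φ₀≤ : Φ (x₀ , init) ≤ (4 + 18 * K) * (n * d ^ 2) * d
    Φ₀≤ = begin
      Φ (x₀ , init)                                 ≤⟨ Φ≤ K m≤K (x₀ , init) ⟩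
      d * S + 2 * (K * d) * ((S + S) + n * d)       ≤⟨ +-mono-≤ (*-monoʳ-≤ d S≤) (*-monoʳ-≤ (2 * (K * d)) (+-mono-≤ (+-mono-≤ S≤ S≤) n*d≤)) ⟩
      d * (4 * n * d ^ 2) + 2 * (K * d) * ((4 * n * d ^ 2 + 4 * n * d ^ 2) + n * d ^ 2) ≡⟨ regroup d n (d ^ 2) K ⟩
      (4 + 18 * K) * (n * d ^ 2) * d                ∎
      where
      regroup : ∀ d n e K → d * (4 * n * e) + 2 * (K * d) * ((4 * n * e + 4 * n * e) + n * e)
                          ≡ (4 + 18 * K) * (n * e) * d
      regroup = solve-∀
    Φ₀< : (4 + 18 * K) * (n * d ^ 2) * d < (5 + 18 * K) * n * d ^ 2 * d
    Φ₀< = begin-strict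
      (4 + 18 * K) * (n * d ^ 2) * d                     <⟨ m<n+m _ positive ⟩
      n * d ^ 2 * d + (4 + 18 * K) * (n * d ^ 2) * d     ≡⟨ regroup d n (d ^ 2) K ⟩
      (5 + 18 * K) * n * d ^ 2 * d                       ∎
      where
      positive : 0 < n * d ^ 2 * d
      positive = *-mono-< {0} {n * d ^ 2} {0} (*-mono-< {0} {n} {0} (m^n>0 2 d) (m^n>0 d 2)) (s≤s z≤n)
      regroup : ∀ d n e K → n * e * d + (4 + 18 * K) * (n * e) * d ≡ (5 + 18 * K) * n * e * d
      regroup = solve-∀
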